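{- Let $p$ be a prime and let $\mathcal{X}=(\Omega,S)$ be a $\{1,p\}$-scheme whose thin residue is isomorphic to an elementary abelian $p$-group of rank greater than two. Then $\mathcal{X}$ is schurian and separable.
   Context: An association scheme on a finite set $\Omega$ is a pair $\mathcal{X}=(\Omega,S)$ where $S$ is a partition of $\Omega\times\Omega$ such that the diagonal $1_\Omega\in S$, $S^*=S$ (where $r^*=\{(\beta,\alpha):(\alpha,\beta)\in r\}$), and for all $r,s,t\in S$ the number $c_{rs}^t=|\alpha r\cap\beta s^*|$ does not depend on $(\alpha,\beta)\in t$; here $\alpha r=\{\beta:(\alpha,\beta)\in r\}$. The valency of $s\in S$ is $n_s=|\alpha s|$; $s$ is thin if $n_s=1$. A $\{1,p\}$-scheme is one in which every basis relation has valency $1$ or $p$, both occurring. For $r,s\in S$ the complex product $rs$ is the set of basis relations contained in the composition $r\cdot s$. The thin residue of $\mathcal{X}$ is the smallest subset of $S$ containing all elements of $ss^*$ for $s\in S$ and closed under complex products; the hypothesis means that it consists of thin relations, which form a group under composition isomorphic to an elementary abelian group $E_{p^m}$ with $m\ge3$. A scheme is schurian if there is a transitive permutation group $K\le\mathrm{Sym}(\Omega)$ whose orbits on $\Omega\times\Omega$ are exactly the elements of $S$. An algebraic isomorphism from $\mathcal{X}$ to a scheme $\mathcal{X}'=(\Omega',S')$ is a bijection $\varphi:S\to S'$ with $c_{rs}^t=c_{r^\varphi s^\varphi}^{t^\varphi}$ for all $r,s,t\in S$; $\mathcal{X}$ is separable if for every such $\varphi$ there exists a bijection $f:\Omega\to\Omega'$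 with $r^f=r^\varphi$ for all $r\in S$. -}

module Defs where

open import Data.Nat using (ℕ; zero; suc; _+_; _%_; _≤_)
open import Data.Nat.DivMod using (m%n<n)
open import Data.Nat.Primality using (Prime)
open import Data.Fin using (Fin; toℕ; fromℕ<; _≟_)
import Data.Fin as F
open import Data.Vec using (Vec; zipWith)
open import Data.Bool using (Bool; if_then_else_)
open import Data.Product using (Σ; ∃; _×_; _,_; proj₁; proj₂)
open import Data.Sum using (_⊎_)
open import Relation.Nullary using (¬_)
open import Relation.Nullary.Decidable using (⌊_⌋)
open import Relation.Binary.PropositionalEquality using (_≡_)
open import Function.Definitions using (Bijective)
open import Data.Fin.Permutation using (Permutation′; _⟨$⟩ʳ_; _∘ₚ_; flip; id)

count : ∀ {n} → (Fin n → Bool) → ℕ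
count {zero}  P = 0
count {suc n} P = (if P F.zero then 1 else 0) + count (λ i → P (F.suc i))

-- Association schemes.  Ω = Fin n, the basis relations are indexed by
-- Fin k, and  rel α β  is the (index of the) basis relation containing
-- (α , β).  Thus S is a partition of Ω×Ω into k classes; 'nonempty'
-- says every class is nonempty (so S is a genuine partition into k blocks).

interCount : ∀ {n k} → (Fin n → Fin n → Fin k) → Fin k → Fin k → Fin n → Fin n → ℕ
interCount rel r s α β = count (λ γ → ⌊ rel α γ ≟ r ⌋ Data.Bool.∧ ⌊ rel γ β ≟ s ⌋)
  where import Data.Bool

record Scheme : Set where
  field
    n    : ℕ
    k    : ℕ
    rel  : Fin n → Fin n → Fin k
    nonempty : ∀ (s : Fin k) → Σ (Fin n × Fin n) (λ ab → rel (proj₁ ab) (proj₂ ab) ≡ s)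
    diag     : Fin k
    diag-to  : ∀ α β → rel α β ≡ diag → α ≡ β
    diag-fro : ∀ α → rel α α ≡ diag
    star      : Fin k → Fin k
    star-spec : ∀ α β → rel β α ≡ star (rel α β)
    regular : ∀ r s α β α' β' → rel α β ≡ rel α' β' →
              interCount rel r s α β ≡ interCount rel r s α' β'

open Scheme public

c : (X : Scheme) → Fin (k X) → Fin (k X) → Fin (k X) → ℕ
c X r s t = interCount (rel X) r s (proj₁ (proj₁ (nonempty X t))) (proj₂ (proj₁ (nonempty X t)))

valencyAt : (X : Scheme) → Fin (n X) → Fin (k X) → ℕ
valencyAt X α s = count (λ β → ⌊ rel X α β ≟ s ⌋)

Thin : (X : Scheme) → Fin (k X) → Set
Thin X s = ∀ α → valencyAt X α s ≡ 1

Is1pScheme : ℕ → Scheme → Set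
Is1pScheme p X =
  (∀ s α → valencyAt X α s ≡ 1 ⊎ valencyAt X α s ≡ p) ×
  (∃ λ s → ∀ α → valencyAt X α s ≡ 1) ×
  (∃ λ s → ∀ α → valencyAt X α s ≡ p)

-- Thin residue: the smallest subset of S containing every element of
-- the complex products s s* and closed under complex products, where
-- t ∈ r s  iff  c_{rs}^t ≠ 0 (i.e. t ⊆ r·s).
data InThinResidue (X : Scheme) : Fin (k X) → Set where
  gen  : ∀ s t → ¬ (c X s (star X s) t ≡ 0) → InThinResidue X t
  prod : ∀ r s t → InThinResidue X r → InThinResidue X s →
         ¬ (c X r s t ≡ 0) → InThinResidue X t

addMod : ∀ {p} → Fin p → Fin p → Fin p
addMod {suc q} a b = fromℕ< (m%n<n (toℕ a + toℕ b) (suc q))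

E+ : ∀ {p m} → Vec (Fin p) m → Vec (Fin p) m → Vec (Fin p) m
E+ = zipWith addMod

-- The thin residue consists of thin relations, and these form a group
-- under composition isomorphic to E_{p^m} (via φ).  For thin r, s the
-- composition r·s is the unique basis relation t with c_{rs}^t ≠ 0.
ThinResidueIsE : ℕ → ℕ → Scheme → Set
ThinResidueIsE p m X =
  (∀ t → InThinResidue X t → Thin X t) ×
  Σ (Vec (Fin p) m → Fin (k X)) λ φ →
    (∀ u v → φ u ≡ φ v → u ≡ v) ×
    (∀ u → InThinResidue X (φ u)) ×
    (∀ t → InThinResidue X t → ∃ λ u → φ u ≡ t) ×
    (∀ u v → ¬ (c X (φ u) (φ v) (φ (E+ u v)) ≡ 0))

Schurian : Scheme → Set₁
Schurian X =
  Σ (Permutation′ (n X) → Set) λ K →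
    K id ×
    (∀ g h → K g → K h → K (g ∘ₚ h)) ×
    (∀ g → K g → K (flip g)) ×
    (∀ α β → ∃ λ g → K g × g ⟨$⟩ʳ α ≡ β) ×
    (∀ α β γ δ →
       (rel X α β ≡ rel X γ δ →
          ∃ λ g → K g × g ⟨$⟩ʳ α ≡ γ × g ⟨$⟩ʳ β ≡ δ) ×
       ((∃ λ g → K g × g ⟨$⟩ʳ α ≡ γ × g ⟨$⟩ʳ β ≡ δ) →
          rel X α β ≡ rel X γ δ))

AlgIso : (X Y : Scheme) → (Fin (k X) → Fin (k Y)) → Set
AlgIso X Y φ = Bijective _≡_ _≡_ φ × (∀ r s t → c X r s t ≡ c Y (φ r) (φ s) (φ t))

Separable : Scheme → Set
Separable X =
  ∀ (Y : Scheme) (φ : Fin (k X) → Fin (k Y)) → AlgIso X Y φ →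
    ∃ λ (f : Fin (n X) → Fin (n Y)) →
      Bijective _≡_ _≡_ f × (∀ α β → rel Y (f α) (f β) ≡ φ (rel X α β))

{-# OPTIONS --safe #-}

-- The thin residue V ≅ E_{p^m} acts freely on the points, and for a basis
-- relation s = rel a b the points in relation s to a form the coset b ▸ Stab a b,
-- where Stab a b = s*s ≤ V has order n_s ∈ {1, p}.  Let φ be an algebraic
-- isomorphism.  A partial map matching
-- φ on three points extends to a fourth point when three pairwise intersecting
-- cosets of such groups have a common point, which can only fail if the groups
-- are coplanar.  As the groups Stab a o (a ∈ Ω) generate V and m ≥ 3, in the
-- coplanar case there is an auxiliary point e with Stab e o outside the plane,
-- and the extension is made through e.  Finally, with Stab h₀ α, Stab h₁ α,
-- Stab h₂ α independent, every image is determined by α and at least two of the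
-- hᵢ, so any two points share an hᵢ through which their images are compared.
-- Hence every match of two pairs of points extends to an isomorphism inducing φ;
-- φ = id gives schurity and arbitrary φ gives separability.
module Submission where

open import Defs
open import Algebra.Bundles using (CommutativeMonoid)
import Algebra.Properties.CommutativeMonoid.Mult as Mult
import Algebra.Properties.CommutativeSemigroup as CommutativeSemigroupProperties
open import Data.Bool using (Bool; true; false; _∧_; not)
open import Data.Bool.Properties using (∧-identityʳ)
open import Data.Empty using (⊥-elim)
open import Data.Fin using (Fin; zero; suc; toℕ; fromℕ<; combine; remQuot)
open import Data.Fin.Permutation using (Permutation′; permutation; flip; _⟨$⟩ʳ_; inverseʳ)
open import Data.Fin.Properties using (_≟_; toℕ-injective; toℕ-fromℕ<; toℕ<n; any?; suc-injective; 0≢1+n; injective⇒≤; combine-remQuot; remQuot-combine)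
open import Data.Nat as ℕ using (ℕ; zero; suc; _+_; _*_; _∸_; _≤_; _<_; z≤n; s≤s; _%_; _/_; NonZero)
open import Data.Nat.DivMod using (m%n<n; m%n%n≡m%n; %-distribˡ-+; m<n⇒m%n≡m; m*n%n≡0; m≡m%n+[m/n]*n)
open import Data.Nat.Divisibility using (_∣_; m%n≡0⇒n∣m; ∣⇒≤)
open import Data.Nat.Primality using (Prime; euclidsLemma; ¬prime[0]; prime⇒nonTrivial)
import Data.Nat.Properties as ℕ
open import Data.Product using (∃; ∃₂; _×_; _,_; proj₁; proj₂)
open import Data.Sum using (_⊎_; inj₁; inj₂; [_,_]′)
open import Data.Vec using (Vec; _∷_; replicate; lookup; tabulate)
import Data.Vec.Properties as Vec
open import Function using (_∘_; id)
open import Function.Definitions using (Bijective)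
open import Relation.Binary.Definitions using (tri<; tri≈; tri>)
open import Relation.Binary.PropositionalEquality
open import Relation.Nullary using (¬_; Dec; yes; no; contradiction)
open import Relation.Nullary.Decidable using (⌊_⌋; ¬?; _×-dec_; decidable-stable)

-- Counting the solutions of Boolean predicates on `Fin n`.

count-witness : ∀ {n} (P : Fin n → Bool) i → P i ≡ true → count P ≢ 0
count-witness P zero    Pi eq rewrite Pi = contradiction eq λ ()
count-witness P (suc i) Pi eq = count-witness (P ∘ suc) i Pi (ℕ.m+n≡0⇒n≡0 _ eq)

count-positive : ∀ {n} (P : Fin n → Bool) → count P ≢ 0 → ∃ λ i → P i ≡ true
count-positive {zero}  P ≢0 = contradiction refl ≢0
count-positive {suc n} P ≢0 with P zero in eq
... | true  = zero , eq
... | false with count-positive (P ∘ suc) ≢0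
...   | i , Pi = suc i , Pi

count-cong : ∀ {n} {P Q : Fin n → Bool} → (∀ i → P i ≡ Q i) → count P ≡ count Q
count-cong {zero}  P≗Q = refl
count-cong {suc n} P≗Q rewrite P≗Q zero = cong (_ +_) (count-cong (P≗Q ∘ suc))

without : ∀ {n} → Fin n → (Fin n → Bool) → Fin n → Bool
without i P j = P j ∧ not ⌊ j ≟ i ⌋

count-without : ∀ {n} (P : Fin n → Bool) i → P i ≡ true → count P ≡ suc (count (without i P))
count-without P zero Pi rewrite Pi =
  cong suc (count-cong λ j → sym (∧-identityʳ (P (suc j))))
count-without {suc n} P (suc i) Pi
  rewrite ∧-identityʳ (P zero) | count-without (P ∘ suc) i Pi =
  trans (ℕ.+-suc _ _) (cong (λ z → suc (_ + z)) (count-cong shift))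
  where
  shift : ∀ j → without i (P ∘ suc) j ≡ without (suc i) P (suc j)
  shift j with j ≟ i
  ... | yes refl = refl
  ... | no _     = refl

injective⇒≤count : ∀ {m n} (P : Fin n → Bool) (f : Fin m → Fin n) →
  (∀ {i j} → f i ≡ f j → i ≡ j) → (∀ i → P (f i) ≡ true) → m ≤ count P
injective⇒≤count {zero}  P f f-inj Pf = z≤n
injective⇒≤count {suc m} P f f-inj Pf rewrite count-without P (f zero) (Pf zero) =
  s≤s (injective⇒≤count (without (f zero) P) (f ∘ suc) (suc-injective ∘ f-inj) P′f)
  where
  P′f : ∀ i → without (f zero) P (f (suc i)) ≡ true
  P′f i rewrite Pf (suc i) with f (suc i) ≟ f zero
  ... | yes eq = contradiction (sym (f-inj eq)) 0≢1+n
  ... | no _   = refl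

-- A solution `y` missed by `f` would extend it to an injection of `Fin (suc m)` into the solutions
-- of `P`, more than the count allows.
injective⇒covers : ∀ {m n} (P : Fin n → Bool) (f : Fin m → Fin n) →
  (∀ {i j} → f i ≡ f j → i ≡ j) → (∀ i → P (f i) ≡ true) → count P ≤ m →
  ∀ y → P y ≡ true → ∃ λ i → f i ≡ y
injective⇒covers {m} {n} P f f-inj Pf ≤m y Py with any? (λ i → f i ≟ y)
... | yes ∃i = ∃i
... | no ∄i = contradiction (ℕ.≤-trans (injective⇒≤count P g g-inj Pg) ≤m) ℕ.1+n≰n
  where
  g : Fin (suc m) → Fin n
  g zero    = y
  g (suc i) = f i
  g-inj : ∀ {i j} → g i ≡ g j → i ≡ j
  g-inj {zero}  {zero}  eq = refl
  g-inj {zero}  {suc j} eq = contradiction (j , sym eq) ∄i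
  g-inj {suc i} {zero}  eq = contradiction (i , eq) ∄i
  g-inj {suc i} {suc j} eq = cong suc (f-inj eq)
  Pg : ∀ i → P (g i) ≡ true
  Pg zero    = Py
  Pg (suc i) = Pf i

count≡1⇒unique : ∀ {n} (P : Fin n → Bool) → count P ≡ 1 → ∀ i j → P i ≡ true → P j ≡ true → i ≡ j
count≡1⇒unique P eq i j Pi Pj with injective⇒covers P (λ (_ : Fin 1) → i)
  (λ { {zero} {zero} _ → refl }) (λ _ → Pi) (ℕ.≤-reflexive eq) j Pj
... | _ , i≡j = i≡j

⌊⌋-true : ∀ {a} {A : Set a} (A? : Dec A) → A → ⌊ A? ⌋ ≡ true
⌊⌋-true (yes _) _ = refl
⌊⌋-true (no ¬a) a = contradiction a ¬a

true-⌊⌋ : ∀ {a} {A : Set a} (A? : Dec A) → ⌊ A? ⌋ ≡ true → A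
true-⌊⌋ (yes a) _ = a

-- Arithmetic in an elementary abelian group.

module ElementaryAbelian (q m : ℕ) (p-prime : Prime (suc q)) where

  p : ℕ
  p = suc q

  V : Set
  V = Vec (Fin p) m

  infixl 6 _⊕_
  _⊕_ : V → V → V
  _⊕_ = E+

  toℕ-addMod : ∀ (a b : Fin p) → toℕ (addMod a b) ≡ (toℕ a + toℕ b) % p
  toℕ-addMod a b = toℕ-fromℕ< _

  %-reduceˡ : ∀ x y → (x % p + y) % p ≡ (x + y) % p
  %-reduceˡ x y = begin
    (x % p + y) % p         ≡⟨ %-distribˡ-+ (x % p) y p ⟩
    (x % p % p + y % p) % p ≡⟨ cong (λ z → (z + y % p) % p) (m%n%n≡m%n x p) ⟩
    (x % p + y % p) % p     ≡⟨ %-distribˡ-+ x y p ⟨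
    (x + y) % p             ∎
    where open ≡-Reasoning

  addMod-comm : ∀ (a b : Fin p) → addMod a b ≡ addMod b a
  addMod-comm a b = toℕ-injective (begin
    toℕ (addMod a b)      ≡⟨ toℕ-addMod a b ⟩
    (toℕ a + toℕ b) % p   ≡⟨ cong (_% p) (ℕ.+-comm (toℕ a) (toℕ b)) ⟩
    (toℕ b + toℕ a) % p   ≡⟨ toℕ-addMod b a ⟨
    toℕ (addMod b a)      ∎)
    where open ≡-Reasoning

  toℕ-addMod₃ : ∀ (a b c : Fin p) → toℕ (addMod (addMod a b) c) ≡ (toℕ a + toℕ b + toℕ c) % p
  toℕ-addMod₃ a b c = begin
    toℕ (addMod (addMod a b) c)           ≡⟨ toℕ-addMod (addMod a b) c ⟩
    (toℕ (addMod a b) + toℕ c) % p        ≡⟨ cong (λ z → (z + toℕ c) % p) (toℕ-addMod a b) ⟩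
    ((toℕ a + toℕ b) % p + toℕ c) % p     ≡⟨ %-reduceˡ (toℕ a + toℕ b) (toℕ c) ⟩
    (toℕ a + toℕ b + toℕ c) % p           ∎
    where open ≡-Reasoning

  addMod-assoc : ∀ (a b c : Fin p) → addMod (addMod a b) c ≡ addMod a (addMod b c)
  addMod-assoc a b c = toℕ-injective (begin
    toℕ (addMod (addMod a b) c)   ≡⟨ toℕ-addMod₃ a b c ⟩
    (toℕ a + toℕ b + toℕ c) % p   ≡⟨ cong (_% p) (trans (ℕ.+-assoc (toℕ a) (toℕ b) (toℕ c)) (ℕ.+-comm (toℕ a) (toℕ b + toℕ c))) ⟩
    (toℕ b + toℕ c + toℕ a) % p   ≡⟨ toℕ-addMod₃ b c a ⟨
    toℕ (addMod (addMod b c) a)   ≡⟨ cong toℕ (addMod-comm (addMod b c) a) ⟩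
    toℕ (addMod a (addMod b c))   ∎)
    where open ≡-Reasoning

  addMod-identityˡ : ∀ (a : Fin p) → addMod zero a ≡ a
  addMod-identityˡ a = toℕ-injective (trans (toℕ-addMod zero a) (m<n⇒m%n≡m (toℕ<n a)))

  addMod-identityʳ : ∀ (a : Fin p) → addMod a zero ≡ a
  addMod-identityʳ a = trans (addMod-comm a zero) (addMod-identityˡ a)

  V-commutativeMonoid : CommutativeMonoid _ _
  V-commutativeMonoid = record
    { Carrier = V ; _≈_ = _≡_ ; _∙_ = _⊕_ ; ε = replicate m zero
    ; isCommutativeMonoid = record
      { isMonoid = record
        { isSemigroup = record
          { isMagma = record { isEquivalence = isEquivalence ; ∙-cong = cong₂ _⊕_ }
          ; assoc = Vec.zipWith-assoc addMod-assoc }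
        ; identity = Vec.zipWith-identityˡ addMod-identityˡ , Vec.zipWith-identityʳ addMod-identityʳ }
      ; comm = Vec.zipWith-comm addMod-comm } }

  open CommutativeMonoid V-commutativeMonoid public
    using () renaming (ε to 𝟎; assoc to ⊕-assoc; comm to ⊕-comm; identityˡ to ⊕-identityˡ; identityʳ to ⊕-identityʳ)
  open CommutativeSemigroupProperties (CommutativeMonoid.commutativeSemigroup V-commutativeMonoid) public
    using (interchange)
  open Mult V-commutativeMonoid public
    using (×-homo-+; ×-assocˡ) renaming (_×_ to infixr 8 _·_; ×-distrib-+ to ·-distrib-⊕)

  _≟ᵛ_ : (u v : V) → Dec (u ≡ v)
  _≟ᵛ_ = Vec.≡-dec _≟_

  lookup-ext : ∀ {u v : V} → (∀ i → lookup u i ≡ lookup v i) → u ≡ v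
  lookup-ext {u} {v} eq = begin
    u                     ≡⟨ Vec.tabulate∘lookup u ⟨
    tabulate (lookup u)   ≡⟨ Vec.tabulate-cong eq ⟩
    tabulate (lookup v)   ≡⟨ Vec.tabulate∘lookup v ⟩
    v                     ∎
    where open ≡-Reasoning

  toℕ-lookup-· : ∀ d (t : V) i → toℕ (lookup (d · t) i) ≡ (d * toℕ (lookup t i)) % p
  toℕ-lookup-· zero    t i = cong toℕ (Vec.lookup-replicate i zero)
  toℕ-lookup-· (suc d) t i = begin
    toℕ (lookup (t ⊕ d · t) i)                  ≡⟨ cong toℕ (Vec.lookup-zipWith addMod i t (d · t)) ⟩
    toℕ (addMod (lookup t i) (lookup (d · t) i)) ≡⟨ cong toℕ (addMod-comm (lookup t i) _) ⟩
    toℕ (addMod (lookup (d · t) i) (lookup t i)) ≡⟨ toℕ-addMod (lookup (d · t) i) (lookup t i) ⟩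
    (toℕ (lookup (d · t) i) + x) % p            ≡⟨ cong (λ z → (z + x) % p) (toℕ-lookup-· d t i) ⟩
    ((d * x) % p + x) % p                       ≡⟨ %-reduceˡ (d * x) x ⟩
    (d * x + x) % p                             ≡⟨ cong (_% p) (ℕ.+-comm (d * x) x) ⟩
    (suc d * x) % p                             ∎
    where
    open ≡-Reasoning
    x = toℕ (lookup t i)

  p·t≡𝟎 : ∀ t → p · t ≡ 𝟎
  p·t≡𝟎 t = lookup-ext λ i → toℕ-injective (begin
    toℕ (lookup (p · t) i)         ≡⟨ toℕ-lookup-· p t i ⟩
    (p * toℕ (lookup t i)) % p     ≡⟨ cong (_% p) (ℕ.*-comm p (toℕ (lookup t i))) ⟩
    (toℕ (lookup t i) * p) % p     ≡⟨ m*n%n≡0 (toℕ (lookup t i)) p ⟩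
    0                              ≡⟨ cong toℕ (Vec.lookup-replicate i zero) ⟨
    toℕ (lookup 𝟎 i)               ∎)
    where open ≡-Reasoning

  d·𝟎≡𝟎 : ∀ d → d · 𝟎 ≡ 𝟎
  d·𝟎≡𝟎 zero    = refl
  d·𝟎≡𝟎 (suc d) = trans (⊕-identityˡ (d · 𝟎)) (d·𝟎≡𝟎 d)

  ·-% : ∀ d t → (d % p) · t ≡ d · t
  ·-% d t = sym (begin
    d · t                               ≡⟨ cong (_· t) (m≡m%n+[m/n]*n d p) ⟩
    (d % p + d / p * p) · t             ≡⟨ ×-homo-+ t (d % p) (d / p * p) ⟩
    (d % p) · t ⊕ (d / p * p) · t       ≡⟨ cong ((d % p) · t ⊕_) (×-assocˡ t (d / p) p) ⟨
    (d % p) · t ⊕ (d / p) · p · t       ≡⟨ cong (λ z → (d % p) · t ⊕ (d / p) · z) (p·t≡𝟎 t) ⟩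
    (d % p) · t ⊕ (d / p) · 𝟎           ≡⟨ cong ((d % p) · t ⊕_) (d·𝟎≡𝟎 (d / p)) ⟩
    (d % p) · t ⊕ 𝟎                     ≡⟨ ⊕-identityʳ _ ⟩
    (d % p) · t                         ∎)
    where open ≡-Reasoning

  ∤<p : ∀ {d} → d ≢ 0 → d < p → ¬ p ∣ d
  ∤<p {zero}  ≢0 _   _   = ≢0 refl
  ∤<p {suc d} _  d<p p∣d = ℕ.<⇒≱ d<p (∣⇒≤ p∣d)

  -- In each coordinate `p` divides a product of two numbers below `p`; by Euclid's lemma one factor
  -- is zero, and it is not `d`.
  torsion : ∀ {d t} → d ≢ 0 → d < p → d · t ≡ 𝟎 → t ≡ 𝟎
  torsion {d} {t} d≢0 d<p d·t≡𝟎 = lookup-ext λ i → toℕ-injective (begin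
    toℕ (lookup t i)   ≡⟨ coordinate i ⟩
    0                  ≡⟨ cong toℕ (Vec.lookup-replicate i zero) ⟨
    toℕ (lookup 𝟎 i)   ∎)
    where
    open ≡-Reasoning
    coordinate : ∀ i → toℕ (lookup t i) ≡ 0
    coordinate i with toℕ (lookup t i) ℕ.≟ 0
    ... | yes ≡0 = ≡0
    ... | no  ≢0 = ⊥-elim ([ ∤<p d≢0 d<p , ∤<p ≢0 (toℕ<n (lookup t i)) ]′
      (euclidsLemma d (toℕ (lookup t i)) p-prime (m%n≡0⇒n∣m _ p (begin
        (d * toℕ (lookup t i)) % p   ≡⟨ toℕ-lookup-· d t i ⟨
        toℕ (lookup (d · t) i)       ≡⟨ cong (λ v → toℕ (lookup v i)) d·t≡𝟎 ⟩
        toℕ (lookup 𝟎 i)             ≡⟨ cong toℕ (Vec.lookup-replicate i zero) ⟩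
        0                            ∎))))

  -- Cancelling `i · t`, with `(p ∸ i) · t` as its inverse, leaves `(j ∸ i) · t ≡ 𝟎`, which
  -- `torsion` excludes.
  ·-≢ : ∀ {t i j} → t ≢ 𝟎 → i < j → j < p → i · t ≢ j · t
  ·-≢ {t} {i} {j} t≢𝟎 i<j j<p eq =
    t≢𝟎 (torsion (ℕ.m>n⇒m∸n≢0 i<j) (ℕ.≤-<-trans (ℕ.m∸n≤m j i) j<p) (begin
      (j ∸ i) · t                               ≡⟨ ⊕-identityˡ _ ⟨
      𝟎 ⊕ (j ∸ i) · t                           ≡⟨ cong (_⊕ (j ∸ i) · t) [p∸i]+i ⟨
      (p ∸ i) · t ⊕ i · t ⊕ (j ∸ i) · t         ≡⟨ ⊕-assoc ((p ∸ i) · t) (i · t) _ ⟩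
      (p ∸ i) · t ⊕ (i · t ⊕ (j ∸ i) · t)       ≡⟨ cong ((p ∸ i) · t ⊕_) (×-homo-+ t i (j ∸ i)) ⟨
      (p ∸ i) · t ⊕ (i + (j ∸ i)) · t           ≡⟨ cong (λ z → (p ∸ i) · t ⊕ z · t) (ℕ.m+[n∸m]≡n (ℕ.<⇒≤ i<j)) ⟩
      (p ∸ i) · t ⊕ j · t                       ≡⟨ cong ((p ∸ i) · t ⊕_) eq ⟨
      (p ∸ i) · t ⊕ i · t                       ≡⟨ [p∸i]+i ⟩
      𝟎                                         ∎))
    where
    open ≡-Reasoning
    [p∸i]+i : (p ∸ i) · t ⊕ i · t ≡ 𝟎
    [p∸i]+i = begin
      (p ∸ i) · t ⊕ i · t   ≡⟨ ×-homo-+ t (p ∸ i) i ⟨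
      (p ∸ i + i) · t       ≡⟨ cong (_· t) (ℕ.m∸n+n≡m (ℕ.<⇒≤ (ℕ.<-trans i<j j<p))) ⟩
      p · t                 ≡⟨ p·t≡𝟎 t ⟩
      𝟎                     ∎

  ·-injective : ∀ {t} → t ≢ 𝟎 → ∀ {i j : Fin p} → toℕ i · t ≡ toℕ j · t → i ≡ j
  ·-injective t≢𝟎 {i} {j} eq with ℕ.<-cmp (toℕ i) (toℕ j)
  ... | tri< i<j _ _ = contradiction eq (·-≢ t≢𝟎 i<j (toℕ<n j))
  ... | tri≈ _ i≡j _ = toℕ-injective i≡j
  ... | tri> _ _ j<i = contradiction (sym eq) (·-≢ t≢𝟎 j<i (toℕ<n i))

  -- Subgroups spanned by two elements.

  Span : V → V → V → Set
  Span u v w = ∃₂ λ i j → w ≡ i · u ⊕ j · v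

  Span-⊕ : ∀ {u v w x} → Span u v w → Span u v x → Span u v (w ⊕ x)
  Span-⊕ {u} {v} (i , j , refl) (k , l , refl) = i + k , j + l , (begin
    (i · u ⊕ j · v) ⊕ (k · u ⊕ l · v)   ≡⟨ interchange (i · u) (j · v) (k · u) (l · v) ⟩
    (i · u ⊕ k · u) ⊕ (j · v ⊕ l · v)   ≡⟨ cong₂ _⊕_ (×-homo-+ u i k) (×-homo-+ v j l) ⟨
    (i + k) · u ⊕ (j + l) · v           ∎)
    where open ≡-Reasoning

  Span-· : ∀ {u v w} d → Span u v w → Span u v (d · w)
  Span-· zero    _ = 0 , 0 , sym (⊕-identityˡ 𝟎)
  Span-· (suc d) s = Span-⊕ s (Span-· d s)

  Span-generatorˡ : ∀ {u v} → Span u v u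
  Span-generatorˡ {u} = 1 , 0 , sym (trans (⊕-identityʳ (1 · u)) (⊕-identityʳ u))

  Span-generatorʳ : ∀ {u v} → Span u v v
  Span-generatorʳ {v = v} = 0 , 1 , sym (trans (⊕-identityˡ (1 · v)) (⊕-identityʳ v))

  -- The coefficients in `Span` are arbitrary naturals; reducing them makes membership in a plane a
  -- finite question.
  mod : ℕ → Fin p
  mod d = fromℕ< (m%n<n d p)

  mod-· : ∀ d t → toℕ (mod d) · t ≡ d · t
  mod-· d t = trans (cong (_· t) (toℕ-fromℕ< (m%n<n d p))) (·-% d t)

  private
    1<p : 1 < p
    1<p = ℕ.nonTrivial⇒n>1 p {{prime⇒nonTrivial p-prime}}

  -- A plane has p² points, fewer than p³.
  ¬plane : 3 ≤ m → ∀ u v → ¬ (∀ w → Span u v w)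
  ¬plane (s≤s (s≤s (s≤s (z≤n {r})))) u v all = ℕ.<⇒≱ p*p<p*p*p (injective⇒≤ {f = code ∘ vector} code-vector-injective)
    where
    instance
      p*p-nonZero : NonZero (p * p)
      p*p-nonZero = ℕ.m*n≢0 p p
    p*p<p*p*p : p * p < p * p * p
    p*p<p*p*p = ℕ.m<m*n (p * p) p 1<p
    vector : Fin (p * p * p) → V
    vector i = let (jk , l) = remQuot {p * p} p i ; (j , k) = remQuot {p} p jk in
               j ∷ k ∷ l ∷ replicate r zero
    unvector : V → Fin (p * p * p)
    unvector (j ∷ k ∷ l ∷ _) = combine (combine j k) l
    unvector-vector : ∀ i → unvector (vector i) ≡ i
    unvector-vector i = trans
      (cong (λ z → combine z (proj₂ (remQuot {p * p} p i))) (combine-remQuot {p} p (proj₁ (remQuot {p * p} p i))))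
      (combine-remQuot {p * p} p i)
    -- The two reduced coefficients still determine the vector, so triples would embed into pairs.
    code : V → Fin (p * p)
    code w = combine (mod (proj₁ (all w))) (mod (proj₁ (proj₂ (all w))))
    combination : Fin p × Fin p → V
    combination (j , k) = toℕ j · u ⊕ toℕ k · v
    decode : Fin (p * p) → V
    decode = combination ∘ remQuot {p} p
    decode-code : ∀ w → decode (code w) ≡ w
    decode-code w = let (i , j , w≡) = all w in begin
      decode (code w)                ≡⟨ cong combination (remQuot-combine {p} {p} (mod i) (mod j)) ⟩
      toℕ (mod i) · u ⊕ toℕ (mod j) · v   ≡⟨ cong₂ _⊕_ (mod-· i u) (mod-· j v) ⟩
      i · u ⊕ j · v                  ≡⟨ w≡ ⟨
      w                              ∎
      where open ≡-Reasoning
    code-vector-injective : ∀ {i j} → code (vector i) ≡ code (vector j) → i ≡ j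
    code-vector-injective {i} {j} eq = begin
      i                                     ≡⟨ unvector-vector i ⟨
      unvector (vector i)                   ≡⟨ cong unvector (decode-code (vector i)) ⟨
      unvector (decode (code (vector i)))   ≡⟨ cong (unvector ∘ decode) eq ⟩
      unvector (decode (code (vector j)))   ≡⟨ cong unvector (decode-code (vector j)) ⟩
      unvector (vector j)                   ≡⟨ unvector-vector j ⟩
      j                                     ∎
      where open ≡-Reasoning

-- Intersection numbers as existence statements about points.

∧-true⁻ : ∀ x y → x ∧ y ≡ true → x ≡ true × y ≡ true
∧-true⁻ true true _ = refl , refl

module SchemeProperties (X : Scheme) where

  flip-rel : ∀ {a b a₁ b₁} → rel X a b ≡ rel X a₁ b₁ → rel X b a ≡ rel X b₁ a₁
  flip-rel {a} {b} {a₁} {b₁} eq = begin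
    rel X b a             ≡⟨ star-spec X a b ⟩
    star X (rel X a b)    ≡⟨ cong (star X) eq ⟩
    star X (rel X a₁ b₁)  ≡⟨ star-spec X a₁ b₁ ⟨
    rel X b₁ a₁           ∎
    where open ≡-Reasoning

  c≡interCount : ∀ {r s t a b} → rel X a b ≡ t → c X r s t ≡ interCount (rel X) r s a b
  c≡interCount {r} {s} {t} {a} {b} ab = regular X r s _ _ a b (trans (proj₂ (nonempty X t)) (sym ab))

  c-intro : ∀ {r s t a b} γ → rel X a γ ≡ r → rel X γ b ≡ s → rel X a b ≡ t → c X r s t ≢ 0
  c-intro {r} {s} {t} {a} {b} γ aγ γb ab c≡0 =
    count-witness _ γ (cong₂ _∧_ (⌊⌋-true (rel X a γ ≟ r) aγ) (⌊⌋-true (rel X γ b ≟ s) γb))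
      (trans (sym (c≡interCount ab)) c≡0)

  opaque
    c-elim : ∀ {r s t a b} → c X r s t ≢ 0 → rel X a b ≡ t → ∃ λ γ → rel X a γ ≡ r × rel X γ b ≡ s
    c-elim {r} {s} {t} {a} {b} c≢0 ab
      with γ , eq ← count-positive _ (c≢0 ∘ trans (c≡interCount ab))
      with p , q ← ∧-true⁻ _ _ eq
      = γ , true-⌊⌋ (rel X a γ ≟ r) p , true-⌊⌋ (rel X γ b ≟ s) q

  -- Over the pair `(α , α)` the second condition on the middle point follows from the first by
  -- transposition.
  valency≡c : ∀ α s → valencyAt X α s ≡ c X s (star X s) (diag X)
  valency≡c α s = sym (trans (c≡interCount (diag-fro X α)) (count-cong same))
    where
    same : ∀ γ → ⌊ rel X α γ ≟ s ⌋ ∧ ⌊ rel X γ α ≟ star X s ⌋ ≡ ⌊ rel X α γ ≟ s ⌋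
    same γ with rel X α γ ≟ s
    ... | yes refl = ⌊⌋-true (rel X γ α ≟ star X s) (star-spec X α γ)
    ... | no _     = refl

  -- The path through `γ` makes an intersection number nonzero, and regularity moves it to the other
  -- pair.
  extend : ∀ {a b a₁ b₁} → rel X a b ≡ rel X a₁ b₁ → ∀ γ →
           ∃ λ γ₁ → rel X a₁ γ₁ ≡ rel X a γ × rel X γ₁ b₁ ≡ rel X γ b
  extend ab γ = c-elim (c-intro γ refl refl ab) refl

-- Algebraic isomorphisms respect the diagonal, transposition and valencies.

module AlgIsoProperties {X Y : Scheme} {φ : Fin (k X) → Fin (k Y)} (φ-iso : AlgIso X Y φ) where
  private
    module X = SchemeProperties X
    module Y = SchemeProperties Y

  φ-injective : ∀ {r s} → φ r ≡ φ s → r ≡ s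
  φ-injective = proj₁ (proj₁ φ-iso)

  φ-preimage : ∀ s → ∃ λ r → φ r ≡ s
  φ-preimage s with r , eq ← proj₂ (proj₁ φ-iso) s = r , eq refl

  φ-c : ∀ r s t → c X r s t ≡ c Y (φ r) (φ s) (φ t)
  φ-c = proj₂ φ-iso

  -- Let `φ r` be the diagonal of `Y`. Since `r` lies in the product of `diag X` and `r`, there is a
  -- path from `y` to `y` by `φ (diag X)` and then by the diagonal, which forces its middle point to
  -- be `y`.
  φ-diag : φ (diag X) ≡ diag Y
  φ-diag with φ-preimage (diag Y)
  ... | r , φr≡diag with (a , b) , ab ← nonempty X r
    with c≢0 ← X.c-intro a (diag-fro X a) ab ab
    with (y , _) , _ ← nonempty Y (diag Y)
    with z , yz , zy ← Y.c-elim {a = y} {b = y} (c≢0 ∘ trans (φ-c _ _ _)) (trans (diag-fro Y y) (sym φr≡diag))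
    with refl ← diag-to Y z y (trans zy φr≡diag)
    = trans (sym yz) (diag-fro Y y)

  -- The diagonal lies in the product of `s` and `star X s`; its image gives a pair in `φ s` whose
  -- reverse is in `φ (star X s)`.
  φ-star : ∀ s → φ (star X s) ≡ star Y (φ s)
  φ-star s with (a , b) , ab ← nonempty X s
    with c≢0 ← X.c-intro b ab (trans (star-spec X a b) (cong (star X) ab)) (diag-fro X a)
    with (y , _) , _ ← nonempty Y (diag Y)
    with z , yz , zy ← Y.c-elim {a = y} {b = y} (c≢0 ∘ trans (φ-c _ _ _)) (trans (diag-fro Y y) (sym φ-diag))
    = trans (sym zy) (trans (star-spec Y y z) (cong (star Y) yz))

  φ-valency : ∀ α β s → valencyAt Y β (φ s) ≡ valencyAt X α s
  φ-valency α β s = begin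
    valencyAt Y β (φ s)                        ≡⟨ Y.valency≡c β (φ s) ⟩
    c Y (φ s) (star Y (φ s)) (diag Y)          ≡⟨ cong₂ (c Y (φ s)) (φ-star s) φ-diag ⟨
    c Y (φ s) (φ (star X s)) (φ (diag X))      ≡⟨ φ-c s (star X s) (diag X) ⟨
    c X s (star X s) (diag X)                  ≡⟨ X.valency≡c α s ⟨
    valencyAt X α s                            ∎
    where open ≡-Reasoning

-- The free action of the thin residue on points, and stabilisers of relations.

module Translates (q m : ℕ) (p-prime : Prime (suc q)) where
  open ElementaryAbelian q m p-prime

  -- These properties survive composing `ψ` with an algebraic isomorphism, so both schemes share the
  -- theory of the action.
  record Translations (X : Scheme) (ψ : V → Fin (k X)) : Set where
    field
      ψ-injective   : ∀ {u v} → ψ u ≡ ψ v → u ≡ v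
      ψ-thin        : ∀ u → Thin X (ψ u)
      ψ-⊕           : ∀ u v → c X (ψ u) (ψ v) (ψ (u ⊕ v)) ≢ 0
      ss*-thin      : ∀ s t → c X s (star X s) t ≢ 0 → ∃ λ u → ψ u ≡ t
      valency≤p     : ∀ s α → valencyAt X α s ≤ p

  module Action {X : Scheme} {ψ : V → Fin (k X)} (T : Translations X ψ) where
    open Translations T
    open SchemeProperties X

    opaque
      translate : ∀ y u → ∃ λ z → rel X y z ≡ ψ u
      translate y u
        with z , eq ← count-positive (λ z → ⌊ rel X y z ≟ ψ u ⌋) (λ ≡0 → contradiction (trans (sym (ψ-thin u y)) ≡0) λ ())
        = z , true-⌊⌋ (rel X y z ≟ ψ u) eq

    infixl 5 _▸_
    _▸_ : Fin (n X) → V → Fin (n X)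
    y ▸ u = proj₁ (translate y u)

    rel-▸ : ∀ y u → rel X y (y ▸ u) ≡ ψ u
    rel-▸ y u = proj₂ (translate y u)

    ▸-unique : ∀ {y z u} → rel X y z ≡ ψ u → z ≡ y ▸ u
    ▸-unique {y} {z} {u} yz = count≡1⇒unique _ (ψ-thin u y) z (y ▸ u)
      (⌊⌋-true (rel X y z ≟ ψ u) yz) (⌊⌋-true (rel X y (y ▸ u) ≟ ψ u) (rel-▸ y u))

    ▸-⊕ : ∀ y u v → y ▸ (u ⊕ v) ≡ y ▸ u ▸ v
    ▸-⊕ y u v with γ , yγ , γz ← c-elim (ψ-⊕ u v) (rel-▸ y (u ⊕ v)) with refl ← ▸-unique yγ = ▸-unique γz

    ▸-injective : ∀ {y u v} → y ▸ u ≡ y ▸ v → u ≡ v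
    ▸-injective {y} {u} {v} eq = ψ-injective (trans (sym (rel-▸ y u)) (trans (cong (rel X y) eq) (rel-▸ y v)))

    ▸-𝟎 : ∀ y → y ▸ 𝟎 ≡ y
    ▸-𝟎 y = sym (▸-unique (begin
      rel X y y           ≡⟨ diag-fro X y ⟩
      diag X              ≡⟨ diag-fro X z ⟨
      rel X z z           ≡⟨ cong (rel X z) (trans (sym (▸-⊕ y 𝟎 𝟎)) (cong (y ▸_) (⊕-identityˡ 𝟎))) ⟨
      rel X z (z ▸ 𝟎)     ≡⟨ rel-▸ z 𝟎 ⟩
      ψ 𝟎                 ∎))
      where
      open ≡-Reasoning
      z = y ▸ 𝟎

    -- Regularity gives a point in the right relation to `a₁` and at `ψ v` from `b₁`; thinness
    -- leaves only `b₁ ▸ v`.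
    ▸-cong-rel : ∀ {a b a₁ b₁} → rel X a b ≡ rel X a₁ b₁ → ∀ v → rel X a (b ▸ v) ≡ rel X a₁ (b₁ ▸ v)
    ▸-cong-rel {a} {b} {a₁} {b₁} ab v with z , az , zb ← extend ab (b ▸ v)
      with refl ← ▸-unique (trans (flip-rel zb) (rel-▸ b v)) = sym az

    opaque
      -- The path from `b` through `a` to `b′` puts `rel X b b′` into some `s s*`.
      same-rel⇒translate : ∀ {a b b′} → rel X a b ≡ rel X a b′ → ∃ λ u → b′ ≡ b ▸ u
      same-rel⇒translate {a} {b} {b′} eq
        with u , ψu≡ ← ss*-thin (rel X b a) (rel X b b′)
               (c-intro a refl (trans (sym eq) (star-spec X b a)) refl)
        = u , ▸-unique (sym ψu≡)

    Stab : Fin (n X) → Fin (n X) → V → Set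
    Stab a b u = rel X a (b ▸ u) ≡ rel X a b

    Stab-⊕ : ∀ {a b u v} → Stab a b u → Stab a b v → Stab a b (u ⊕ v)
    Stab-⊕ {a} {b} {u} {v} Su Sv = trans (cong (rel X a) (▸-⊕ b u v)) (trans (▸-cong-rel Su v) Sv)

    Stab-· : ∀ {a b u} d → Stab a b u → Stab a b (d · u)
    Stab-· {a} {b} zero Su = cong (rel X a) (▸-𝟎 b)
    Stab-· (suc d) Su = Stab-⊕ Su (Stab-· d Su)

    -- The `p` distinct points `b ▸ d · t` already exhaust a neighbourhood of size at most `p`.
    Stab-multiple : ∀ {a b t} → t ≢ 𝟎 → Stab a b t → ∀ {u} → Stab a b u → ∃ λ d → u ≡ d · t
    Stab-multiple {a} {b} {t} t≢𝟎 St {u} Su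
      with d , eq ← injective⇒covers (λ y → ⌊ rel X a y ≟ rel X a b ⌋) (λ (d : Fin p) → b ▸ toℕ d · t)
             (·-injective t≢𝟎 ∘ ▸-injective)
             (λ d → ⌊⌋-true (rel X a (b ▸ toℕ d · t) ≟ rel X a b) (Stab-· (toℕ d) St))
             (valency≤p (rel X a b) a) (b ▸ u) (⌊⌋-true (rel X a (b ▸ u) ≟ rel X a b) Su)
      = toℕ d , sym (▸-injective eq)

    Stab-⊆ : ∀ {a b a₁ b₁ t} → t ≢ 𝟎 → Stab a b t → Stab a₁ b₁ t → ∀ {u} → Stab a b u → Stab a₁ b₁ u
    Stab-⊆ t≢𝟎 St S₁t Su with d , refl ← Stab-multiple t≢𝟎 St Su = Stab-· d S₁t

    Disjoint : Fin (n X) → Fin (n X) → Fin (n X) → Set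
    Disjoint a b o = ∀ u → Stab a o u → Stab b o u → u ≡ 𝟎

    Disjoint-sym : ∀ {a b o} → Disjoint a b o → Disjoint b a o
    Disjoint-sym D u Sb Sa = D u Sa Sb

    ¬Stab⇒Disjoint : ∀ {a b o t} → Stab b o t → ¬ Stab a o t → Disjoint a b o
    ¬Stab⇒Disjoint Sb ¬Sa u Sau Sbu with u ≟ᵛ 𝟎
    ... | yes u≡𝟎 = u≡𝟎
    ... | no  u≢𝟎 = contradiction (Stab-⊆ u≢𝟎 Sbu Sau Sb) ¬Sa

    -- When `o` moves by `w`, regularity moves `b` to some `b₁` in the same relation to `a`. The
    -- translation from `b₁` back to `b` lies in `Stab a b`, hence in `Stab o b`, so `b` itself sees
    -- `o` and `o ▸ w` alike.
    Stab-triangle : ∀ {a b o} → (∀ {u} → Stab a b u → Stab o b u) → ∀ {u} → Stab a o u → Stab b o u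
    Stab-triangle {a} {b} {o} ⊆ {w} Sw with b₁ , ab₁ , b₁o ← extend (sym Sw) b
      with u , refl ← same-rel⇒translate {b = b₁} {b′ = b} ab₁
      = flip-rel (trans (▸-cong-rel ob₁ u) (⊆ Su))
      where
      ob₁ : rel X (o ▸ w) b₁ ≡ rel X o (b₁ ▸ u)
      ob₁ = flip-rel b₁o
      Su : Stab a (b₁ ▸ u) u
      Su = ▸-cong-rel (sym ab₁) u

    -- A nonzero common element at `b` gives the inclusion needed by `Stab-triangle`, which then
    -- puts `t` into both stabilisers at `o`.
    Disjoint-rotate : ∀ {a b o t} → t ≢ 𝟎 → Stab a o t → Disjoint a b o → Disjoint a o b
    Disjoint-rotate {t = t} t≢𝟎 St D u Sau Sou with u ≟ᵛ 𝟎
    ... | yes u≡𝟎 = u≡𝟎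
    ... | no  u≢𝟎 = contradiction (D t St (Stab-triangle (Stab-⊆ u≢𝟎 Sau Sou) St)) t≢𝟎

    -- The form in which the rank enters the extension argument. As `u` and `v` may be dependent, it
    -- also provides a way out of a line or of `𝟎`.
    Escapes : Set
    Escapes = ∀ o u v → ∃₂ λ a t → Stab a o t × ¬ Span u v t

  -- The stabilisers at one point generate the thin residue.

  module Residue {X : Scheme} {ψ : V → Fin (k X)} (T : Translations X ψ) where
    open Translations T
    open SchemeProperties X
    open Action T

    ψ-product : ∀ {u v t a b} → c X (ψ u) (ψ v) t ≢ 0 → rel X a b ≡ t → ψ (u ⊕ v) ≡ t
    ψ-product {u} {v} {a = a} c≢0 ab with γ , aγ , γb ← c-elim c≢0 ab
      with refl ← ▸-unique aγ with refl ← ▸-unique γb =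
      trans (sym (rel-▸ a (u ⊕ v))) (trans (cong (rel X a) (▸-⊕ a u v)) ab)

    -- An element of `s s*` realised as a path from `o` through `z` to `o ▸ u` says precisely that
    -- `u` lies in `Stab z o`; complex products become sums.
    residue-⊆ : ∀ {W : V → Set} o → (∀ {u v} → W u → W v → W (u ⊕ v)) → (∀ a {u} → Stab a o u → W u) →
                ∀ {t} → InThinResidue X t → ∃ λ u → ψ u ≡ t × W u
    residue-⊆ o W-⊕ Stab⊆W (gen s t c≢0) with u , refl ← ss*-thin s t c≢0
      with z , refl , zy ← c-elim c≢0 (rel-▸ o u)
      = u , refl , Stab⊆W z (trans zy (sym (star-spec X o z)))
    residue-⊆ o W-⊕ Stab⊆W (prod r s t r∈ s∈ c≢0)
      with u , refl , Wu ← residue-⊆ o W-⊕ Stab⊆W r∈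
      with v , refl , Wv ← residue-⊆ o W-⊕ Stab⊆W s∈
      = u ⊕ v , ψ-product c≢0 (proj₂ (nonempty X t)) , W-⊕ Wu Wv

    inPlane? : ∀ o u v y → Dec (∃₂ λ (i j : Fin p) → y ≡ (o ▸ toℕ i · u ⊕ toℕ j · v))
    inPlane? o u v y = any? λ i → any? λ j → y ≟ (o ▸ toℕ i · u ⊕ toℕ j · v)

    opaque
      -- A finite search over pairs of points. If it fails, every stabiliser at `o` lies in the
      -- plane, hence so does the whole group, against `¬plane`.
      escapes : 3 ≤ m → (∀ u → InThinResidue X (ψ u)) → Escapes
      escapes 3≤m ψ∈ o u v with any? (λ a → any? λ y → rel X a y ≟ rel X a o ×-dec ¬? (inPlane? o u v y))
      ... | yes (a , y , ay , y∉) with t , refl ← same-rel⇒translate (sym ay) =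
        a , t , ay , λ { (i , j , refl) → y∉ (mod i , mod j , cong (o ▸_) (sym (cong₂ _⊕_ (mod-· i u) (mod-· j v)))) }
      ... | no ∄ = ⊥-elim (¬plane 3≤m u v λ w → inSpan (residue-⊆ o Span-⊕ Stab⊆Span (ψ∈ w)))
        where
        inSpan : ∀ {w} → (∃ λ x → ψ x ≡ ψ w × Span u v x) → Span u v w
        inSpan (x , eq , s) = subst (Span u v) (ψ-injective eq) s
        Stab⊆Span : ∀ a {w} → Stab a o w → Span u v w
        Stab⊆Span a {w} Sw
          with i , j , eq ← decidable-stable (inPlane? o u v (o ▸ w)) (λ ∉ → ∄ (a , o ▸ w , Sw , ∉))
          = toℕ i , toℕ j , ▸-injective eq

  -- Matching points of two schemes along an algebraic isomorphism.

  module Extension {X : Scheme} {ψ : V → Fin (k X)} (T : Translations X ψ) (X-escapes : Action.Escapes T)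
                   {Y : Scheme} {φ : Fin (k X) → Fin (k Y)} (φ-iso : AlgIso X Y φ) where
    open Action T
    open AlgIsoProperties {X} {Y} {φ} φ-iso
    private
      module SX = SchemeProperties X
      module SY = SchemeProperties Y

    opaque
      Y-translations : Translations Y (φ ∘ ψ)
      Y-translations = record
        { ψ-injective = ψ-injective ∘ φ-injective
        ; ψ-thin      = λ u α → trans (φ-valency x₀ α (ψ u)) (ψ-thin u x₀)
        ; ψ-⊕         = λ u v → ψ-⊕ u v ∘ trans (φ-c _ _ _)
        ; ss*-thin    = ss*
        ; valency≤p   = valency
        }
        where
        open Translations T
        x₀ : Fin (n X)
        x₀ = proj₁ (proj₁ (nonempty X (diag X)))
        ss* : ∀ s t → c Y s (star Y s) t ≢ 0 → ∃ λ u → φ (ψ u) ≡ t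
        ss* s t c≢0 with r , refl ← φ-preimage s with v , refl ← φ-preimage t
          with u , refl ← ss*-thin r v (λ c≡0 → c≢0 (trans (cong (λ z → c Y (φ r) z (φ v)) (sym (φ-star r))) (trans (sym (φ-c _ _ _)) c≡0)))
          = u , refl
        valency : ∀ s α → valencyAt Y α s ≤ p
        valency s α with r , refl ← φ-preimage s = ℕ.≤-trans (ℕ.≤-reflexive (φ-valency x₀ α r)) (valency≤p r x₀)

    private module Y = Action Y-translations

    infix 4 _~_
    -- Points are paired with candidate images instead of being mapped by a function, so that
    -- several candidates for one point can be compared.
    record _~_ (x y : Fin (n X) × Fin (n Y)) : Set where
      constructor matching
      field rel-φ : rel Y (proj₂ x) (proj₂ y) ≡ φ (rel X (proj₁ x) (proj₁ y))
    open _~_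

    ~-refl : ∀ {x} → x ~ x
    ~-refl {a , a′} = matching (trans (diag-fro Y a′) (trans (sym φ-diag) (cong φ (sym (diag-fro X a)))))

    ~-sym : ∀ {x y} → x ~ y → y ~ x
    ~-sym {a , a′} {b , b′} (matching a~b) = matching (begin
      rel Y b′ a′              ≡⟨ star-spec Y a′ b′ ⟩
      star Y (rel Y a′ b′)     ≡⟨ cong (star Y) a~b ⟩
      star Y (φ (rel X a b))   ≡⟨ φ-star (rel X a b) ⟨
      φ (star X (rel X a b))   ≡⟨ cong φ (star-spec X a b) ⟨
      φ (rel X b a)            ∎)
      where open ≡-Reasoning

    ~-functional : ∀ {a a′ a″} → (a , a′) ~ (a , a″) → a′ ≡ a″
    ~-functional {a} (matching a~a) = diag-to Y _ _ (trans a~a (trans (cong φ (diag-fro X a)) φ-diag))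

    opaque
      -- The path through `d` is counted by a nonzero intersection number, which `φ` preserves.
      third : ∀ {x y} → x ~ y → ∀ d → ∃ λ d′ → x ~ (d , d′) × y ~ (d , d′)
      third {x} {y} x~y d
        with d′ , xd , dy ← SY.c-elim (SX.c-intro d refl refl refl ∘ trans (φ-c _ _ _)) (rel-φ x~y)
        = d′ , matching xd , ~-sym (matching dy)

    opaque
      -- The path from the image of `x` through `w` to `w Y.▸ u` is pulled back along `φ` to one in
      -- `X`.
      Stab-transfer : ∀ {x d w u} → x ~ (d , w) → x ~ (d , w Y.▸ u) → Stab (proj₁ x) d u
      Stab-transfer {a , a′} {d} {w} {u} (matching x~w) (matching x~wu)
        with z , az , zd ← SX.c-elim (SY.c-intro w x~w (Y.rel-▸ w u) x~wu ∘ trans (sym (φ-c _ _ _))) refl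
        with refl ← ▸-unique zd
        = ▸-cong-rel (sym az) u

    opaque
      difference : ∀ {x d w w₁} → x ~ (d , w) → x ~ (d , w₁) → ∃ λ u → w₁ ≡ w Y.▸ u × Stab (proj₁ x) d u
      difference x~w x~w₁ with u , refl ← Y.same-rel⇒translate (trans (rel-φ x~w) (sym (rel-φ x~w₁))) =
        u , refl , Stab-transfer x~w x~w₁

    opaque
      -- Two candidates differ by an element of both stabilisers at `d`.
      unique : ∀ {x y d w w₁} → Disjoint (proj₁ x) (proj₁ y) d →
               x ~ (d , w) → y ~ (d , w) → x ~ (d , w₁) → y ~ (d , w₁) → w₁ ≡ w
      unique {w = w} disjoint x~w y~w x~w₁ y~w₁ with u , refl , Su ← difference x~w x~w₁
        with refl ← disjoint u Su (Stab-transfer y~w y~w₁) = Y.▸-𝟎 w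

    -- Extending three matched points to a fourth.

    Fourth : (x y z : Fin (n X) × Fin (n Y)) → Fin (n X) → Set
    Fourth x y z d = ∃ λ d′ → x ~ (d , d′) × y ~ (d , d′) × z ~ (d , d′)

    Extends : (a b c d : Fin (n X)) → Set
    Extends a b c d = ∀ {a′ b′ c′} → (a , a′) ~ (b , b′) → (a , a′) ~ (c , c′) → (b , b′) ~ (c , c′) →
                      Fourth (a , a′) (b , b′) (c , c′) d

    -- The sides of a nondegenerate triangle of candidates for `d`. Since stabilisers are cyclic,
    -- all three lie in the plane of `u` and `v`.
    record Obstruction (a b c d : Fin (n X)) : Set where
      constructor obstruction
      field
        {u v}  : V
        u≢𝟎    : u ≢ 𝟎
        v≢𝟎    : v ≢ 𝟎
        u⊕v≢𝟎  : u ⊕ v ≢ 𝟎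
        Stab-u   : Stab a d u
        Stab-v   : Stab c d v
        Stab-u⊕v : Stab b d (u ⊕ v)

    opaque
      -- Each pair among `x`, `y`, `z` has a common candidate for `d`. If two of these three
      -- candidates coincide, they match all three points; otherwise their differences form an
      -- obstruction.
      fourth : ∀ {x y z} d → x ~ y → x ~ z → y ~ z →
               Fourth x y z d ⊎ Obstruction (proj₁ x) (proj₁ y) (proj₁ z) d
      fourth d x~y x~z y~z
        with w , x~w , y~w ← third x~y d
        with w₁ , x~w₁ , z~w₁ ← third x~z d
        with w₂ , y~w₂ , z~w₂ ← third y~z d
        with u , refl , Su ← difference x~w x~w₁
        with s , refl , Ss ← difference y~w y~w₂
        with v , eq , Sv ← difference z~w₁ z~w₂
        -- The triangle closes up: the step from `w` to `w₂` is the sum of those through `w₁`.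
        with refl ← Y.▸-injective {u = s} {v = u ⊕ v} (trans eq (sym (Y.▸-⊕ w u v)))
        with u ≟ᵛ 𝟎 | v ≟ᵛ 𝟎 | (u ⊕ v) ≟ᵛ 𝟎
      ... | yes refl | _ | _ = inj₁ (w , x~w , y~w , subst (λ y → _ ~ (d , y)) (Y.▸-𝟎 w) z~w₁)
      ... | _ | yes refl | _ = inj₁ (_ , x~w₁ , subst (λ y → _ ~ (d , y)) (trans eq (Y.▸-𝟎 _)) y~w₂ , z~w₁)
      ... | _ | _ | yes u⊕v≡𝟎 = inj₁ (w , x~w , y~w , subst (λ y → _ ~ (d , y)) (trans (cong (w Y.▸_) u⊕v≡𝟎) (Y.▸-𝟎 w)) z~w₂)
      ... | no u≢𝟎 | no v≢𝟎 | no u⊕v≢𝟎 = inj₂ (obstruction u≢𝟎 v≢𝟎 u⊕v≢𝟎 Su Sv Ss)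

    opaque
      Extends-swap : ∀ {a b c d} → Extends a b c d → Extends a c b d
      Extends-swap E a~c a~b c~b with d′ , a~d , b~d , c~d ← E a~b a~c (~-sym c~b) = d′ , a~d , c~d , b~d

    opaque
      -- An image of `c` found from `a` and `b` leads to an image of `d`, which disjointness
      -- identifies with the given one.
      Extends-exchange : ∀ {a b c d} → Disjoint a b d → Extends a b c d → Extends a b d c
      Extends-exchange disjoint E a~b a~d b~d
        with c′ , a~c , b~c ← third a~b _
        with d″ , a~d″ , b~d″ , c~d″ ← E a~b a~c b~c
        with refl ← unique disjoint a~d b~d a~d″ b~d″
        = c′ , a~c , b~c , ~-sym c~d″

    Within : (a o : Fin (n X)) (u v : V) → Set
    Within a o u v = ∀ {w} → Stab a o w → Span u v w

    opaque
      within : ∀ {a o u v t} → t ≢ 𝟎 → Stab a o t → Span u v t → Within a o u v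
      within t≢𝟎 St s Sw with d , refl ← Stab-multiple t≢𝟎 St Sw = Span-· d s

    module Outside {e o u v t} (Stab-t : Stab e o t) (t∉ : ¬ Span u v t) where

      -- A nonzero `w` generates `Stab e o`, so `t` would lie in the plane too.
      outside : ∀ {w} → Stab e o w → Span u v w → w ≡ 𝟎
      outside {w} Sw w∈ with w ≟ᵛ 𝟎
      ... | yes w≡𝟎 = w≡𝟎
      ... | no  w≢𝟎 = contradiction (within w≢𝟎 Sw w∈ Stab-t) t∉

      outside-Disjoint : ∀ {a} → Within a o u v → Disjoint a e o
      outside-Disjoint Wa w Saw Sew = outside Sew (Wa Saw)

      opaque
        -- An obstruction would put the nonzero `u ⊕ v` both into the plane and into `Stab e o`.
        outside-Extends : ∀ {a b} → Within a o u v → Within b o u v → Extends a e b o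
        outside-Extends Wa Wb a~e a~b e~b with fourth o a~e a~b e~b
        ... | inj₁ F = F
        ... | inj₂ (obstruction _ _ u⊕v≢𝟎 Su Sv Suv) = contradiction (outside Suv (Span-⊕ (Wa Su) (Wb Sv))) u⊕v≢𝟎

      outside-≢𝟎 : t ≢ 𝟎
      outside-≢𝟎 refl = t∉ (0 , 0 , sym (⊕-identityˡ 𝟎))

    opaque
      -- With `e` outside the obstructing plane, first `e` receives an image, then `c` receives one
      -- from `a`, `e`, `o` and one from `b`, `e`, `o`. They agree because `e` and `o` determine the
      -- image of `c`.
      obstructed-Extends : ∀ {a b c o} → Obstruction a b c o → Disjoint a b o → Extends a b o c
      obstructed-Extends {a} {b} {c} {o} (obstruction {u} {v} u≢𝟎 v≢𝟎 u⊕v≢𝟎 Su Sv Suv) disjoint {a′} {b′} {o′} a~b a~o b~o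
        with e , t , St , t∉ ← X-escapes o u v = conclusion
        where
        open Outside St t∉
        Wa : Within a o u v
        Wa = within u≢𝟎 Su Span-generatorˡ
        Wb : Within b o u v
        Wb = within u⊕v≢𝟎 Suv (Span-⊕ Span-generatorˡ Span-generatorʳ)
        Wc : Within c o u v
        Wc = within v≢𝟎 Sv Span-generatorʳ
        conclusion : Fourth (a , a′) (b , b′) (o , o′) c
        conclusion
          with e′ , a~e , b~e , o~e ← Extends-exchange disjoint (Extends-swap (outside-Extends Wa Wb)) a~b a~o b~o
          with c′ , a~c , e~c , o~c ← Extends-exchange (outside-Disjoint Wa) (outside-Extends Wa Wc) a~e a~o (~-sym o~e)
          with c″ , b~c″ , e~c″ , o~c″ ← Extends-exchange (outside-Disjoint Wb) (outside-Extends Wb Wc) b~e b~o (~-sym o~e)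
          with refl ← unique (Disjoint-rotate outside-≢𝟎 St (Disjoint-sym (outside-Disjoint Wc))) e~c o~c e~c″ o~c″
          = c′ , a~c , b~c″ , o~c

    opaque
      -- A candidate for `c` from `a` and `o` works unless there is an obstruction at `b`. That
      -- makes `Stab a b` nontrivial and moves disjointness to `o`; a candidate from `a` and `b`
      -- then works unless there is an obstruction at `o` as well, the case of `obstructed-Extends`.
      disjoint⇒Extends : ∀ {a o b c} → Disjoint a o b → Extends a o b c
      disjoint⇒Extends {a} {o} {b} {c} disjoint a~o a~b o~b
        with c₁ , a~c₁ , o~c₁ ← third a~o c
        with fourth b a~c₁ a~o (~-sym o~c₁)
      ... | inj₁ (b₁ , a~b₁ , c~b₁ , o~b₁) with refl ← unique disjoint a~b o~b a~b₁ o~b₁ =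
        c₁ , a~c₁ , o~c₁ , ~-sym c~b₁
      ... | inj₂ (obstruction u≢𝟎 _ _ Su _ _)
        with disjoint′ ← Disjoint-rotate u≢𝟎 Su disjoint
        with c₂ , a~c₂ , b~c₂ ← third a~b c
        with fourth o a~b a~c₂ b~c₂
      ...   | inj₁ (o₁ , a~o₁ , b~o₁ , c~o₁) with refl ← unique disjoint′ a~o (~-sym o~b) a~o₁ b~o₁ =
        c₂ , a~c₂ , ~-sym c~o₁ , b~c₂
      ...   | inj₂ O with c′ , a~c , b~c , o~c ← obstructed-Extends O disjoint′ a~b a~o (~-sym o~b) =
        c′ , a~c , o~c , b~c

    -- A global isomorphism from a base of four matched points.

    module FromBase {α α′} (h : Fin 3 → Fin (n X)) (h′ : Fin 3 → Fin (n Y)) (t : Fin 3 → V)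
      (α~h : ∀ i → (α , α′) ~ (h i , h′ i)) (h~h : ∀ i j → (h i , h′ i) ~ (h j , h′ j))
      (t≢𝟎 : ∀ i → t i ≢ 𝟎) (Stab-t : ∀ i → Stab (h i) α (t i))
      (independent : ∀ {i j a} → i ≢ j → Stab a α (t i) → ¬ Stab a α (t j)) where

      Good : Fin (n X) → Fin 3 → Set
      Good a i = ¬ Stab a α (t i)

      -- Thus a good index is one for which `α` and `h i` determine the image of `a`.
      good⇒Disjoint : ∀ {a i} → Good a i → Disjoint α (h i) a
      good⇒Disjoint {a} {i} good = Disjoint-sym (Disjoint-rotate (t≢𝟎 i) (Stab-t i) (Disjoint-sym (¬Stab⇒Disjoint (Stab-t i) good)))

      opaque
        -- No stabiliser contains two of the `t i`, so each of `a` and `b` rules out at most one of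
        -- the three indices.
        good₂ : ∀ a b → ∃ λ i → Good a i × Good b i
        good₂ a b with rel X a (α ▸ t zero) ≟ rel X a α | rel X b (α ▸ t zero) ≟ rel X b α
        ... | no ga  | no gb = zero , ga , gb
        ... | yes Sa | _ = choose
          where
          choose : ∃ λ i → Good a i × Good b i
          choose with rel X b (α ▸ t (suc zero)) ≟ rel X b α
          ... | no gb  = suc zero , independent (λ ()) Sa , gb
          ... | yes Sb = suc (suc zero) , independent (λ ()) Sa , independent (λ ()) Sb
        ... | _ | yes Sb = choose
          where
          choose : ∃ λ i → Good a i × Good b i
          choose with rel X a (α ▸ t (suc zero)) ≟ rel X a α
          ... | no ga  = suc zero , ga , independent (λ ()) Sb
          ... | yes Sa = suc (suc zero) , independent (λ ()) Sa , independent (λ ()) Sb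

      opaque
        -- The image is fixed by `α` and one good `h i`. For another `h j`, the matched points `α`,
        -- `h i`, `h j` extend to `a`, and uniqueness gives the same image.
        image : ∀ a → ∃ λ a′ → (α , α′) ~ (a , a′) × ∀ j → (h j , h′ j) ~ (a , a′)
        image a with i , good , _ ← good₂ a a with a′ , α~a , hᵢ~a ← third (α~h i) a = a′ , α~a , h~a
          where
          h~a : ∀ j → (h j , h′ j) ~ (a , a′)
          h~a j with i ≟ j
          ... | yes refl = hᵢ~a
          ... | no i≢j
            with a″ , α~a″ , hᵢ~a″ , hⱼ~a″ ←
                   disjoint⇒Extends (good⇒Disjoint (λ S → independent i≢j S (Stab-t j))) (α~h i) (α~h j) (h~h i j)
            with refl ← unique (good⇒Disjoint good) α~a hᵢ~a α~a″ hᵢ~a″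
            = hⱼ~a″

      f : Fin (n X) → Fin (n Y)
      f a = proj₁ (image a)

      α~f : ∀ a → (α , α′) ~ (a , f a)
      α~f a = proj₁ (proj₂ (image a))

      h~f : ∀ i a → (h i , h′ i) ~ (a , f a)
      h~f i a = proj₂ (proj₂ (image a)) i

      f~f : ∀ a b → (a , f a) ~ (b , f b)
      -- Through a shared good index, `α`, `h i` and `a` extend to `b`, with image forced to be
      -- `f b`.
      f~f a b with i , good-a , good-b ← good₂ a b
        with b′ , α~b , h~b , a~b ← disjoint⇒Extends (good⇒Disjoint good-a) (α~h i) (α~f a) (h~f i a)
        with refl ← unique (good⇒Disjoint good-b) (α~f b) (h~f i b) α~b h~b
        = a~b

    -- Every matched pair extends to an isomorphism.

    Isomorphism : (α β : Fin (n X)) (α′ β′ : Fin (n Y)) → Set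
    Isomorphism α β α′ β′ = ∃ λ (f : Fin (n X) → Fin (n Y)) → (∀ a b → (a , f a) ~ (b , f b)) × f α ≡ α′ × f β ≡ β′

    opaque
      nontrivial⇒isomorphism : ∀ {α β α′ β′ t₀} → t₀ ≢ 𝟎 → Stab β α t₀ → (α , α′) ~ (β , β′) → Isomorphism α β α′ β′
      nontrivial⇒isomorphism {α} {β} {α′} {β′} {t₀} t₀≢𝟎 St₀ α~β
        -- `t₁` is chosen off the line of `t₀`, and `t₂` off the plane of `t₀` and `t₁`; `β` itself
        -- is the first base point.
        with h₁ , t₁ , St₁ , t₁∉ ← X-escapes α t₀ t₀
        with h₂ , t₂ , St₂ , t₂∉ ← X-escapes α t₀ t₁
        with x₁ , α~x₁ , β~x₁ ← third α~β h₁
        = result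
        where
        multiple∉ : ∀ {a u v s t} → Span u v s → ¬ Span u v t → s ≢ 𝟎 → Stab a α s → ¬ Stab a α t
        multiple∉ s∈ t∉ s≢𝟎 Ss St = t∉ (within s≢𝟎 Ss s∈ St)
        t₁≢𝟎 : t₁ ≢ 𝟎
        t₁≢𝟎 = Outside.outside-≢𝟎 St₁ t₁∉
        t₂≢𝟎 : t₂ ≢ 𝟎
        t₂≢𝟎 = Outside.outside-≢𝟎 St₂ t₂∉
        01-independent : ∀ {a} → Stab a α t₀ → ¬ Stab a α t₁
        01-independent = multiple∉ Span-generatorˡ t₁∉ t₀≢𝟎
        02-independent : ∀ {a} → Stab a α t₀ → ¬ Stab a α t₂
        02-independent = multiple∉ Span-generatorˡ t₂∉ t₀≢𝟎
        12-independent : ∀ {a} → Stab a α t₁ → ¬ Stab a α t₂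
        12-independent = multiple∉ Span-generatorʳ t₂∉ t₁≢𝟎
        h₁-Disjoint : Disjoint α β h₁
        h₁-Disjoint = Disjoint-sym (Disjoint-rotate t₀≢𝟎 St₀ (¬Stab⇒Disjoint St₁ (01-independent St₀)))
        result : Isomorphism α β α′ β′
        result with x₂ , α~x₂ , β~x₂ , x₁~x₂ ← disjoint⇒Extends h₁-Disjoint α~β α~x₁ β~x₁
          = f , f~f , sym (~-functional (α~f α)) , sym (~-functional (h~f zero β))
          where
          h : Fin 3 → Fin (n X)
          h zero             = β
          h (suc zero)       = h₁
          h (suc (suc zero)) = h₂
          h′ : Fin 3 → Fin (n Y)
          h′ zero             = β′
          h′ (suc zero)       = x₁
          h′ (suc (suc zero)) = x₂
          t : Fin 3 → V
          t zero             = t₀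
          t (suc zero)       = t₁
          t (suc (suc zero)) = t₂
          α~h : ∀ i → (α , α′) ~ (h i , h′ i)
          α~h zero             = α~β
          α~h (suc zero)       = α~x₁
          α~h (suc (suc zero)) = α~x₂
          h~h : ∀ i j → (h i , h′ i) ~ (h j , h′ j)
          h~h zero             zero             = ~-refl
          h~h zero             (suc zero)       = β~x₁
          h~h zero             (suc (suc zero)) = β~x₂
          h~h (suc zero)       zero             = ~-sym β~x₁
          h~h (suc zero)       (suc zero)       = ~-refl
          h~h (suc zero)       (suc (suc zero)) = x₁~x₂
          h~h (suc (suc zero)) zero             = ~-sym β~x₂
          h~h (suc (suc zero)) (suc zero)       = ~-sym x₁~x₂
          h~h (suc (suc zero)) (suc (suc zero)) = ~-refl
          t≢𝟎 : ∀ i → t i ≢ 𝟎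
          t≢𝟎 zero             = t₀≢𝟎
          t≢𝟎 (suc zero)       = t₁≢𝟎
          t≢𝟎 (suc (suc zero)) = t₂≢𝟎
          Stab-t : ∀ i → Stab (h i) α (t i)
          Stab-t zero             = St₀
          Stab-t (suc zero)       = St₁
          Stab-t (suc (suc zero)) = St₂
          independent : ∀ {i j a} → i ≢ j → Stab a α (t i) → ¬ Stab a α (t j)
          independent {zero}             {zero}             i≢j _  _  = i≢j refl
          independent {zero}             {suc zero}         _   S₀ S₁ = 01-independent S₀ S₁
          independent {zero}             {suc (suc zero)}   _   S₀ S₂ = 02-independent S₀ S₂
          independent {suc zero}         {zero}             _   S₁ S₀ = 01-independent S₀ S₁
          independent {suc zero}         {suc zero}         i≢j _  _  = i≢j refl
          independent {suc zero}         {suc (suc zero)}   _   S₁ S₂ = 12-independent S₁ S₂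
          independent {suc (suc zero)}   {zero}             _   S₂ S₀ = 02-independent S₀ S₂
          independent {suc (suc zero)}   {suc zero}         _   S₂ S₁ = 12-independent S₁ S₂
          independent {suc (suc zero)}   {suc (suc zero)}   i≢j _  _  = i≢j refl
          open FromBase h h′ t α~h h~h t≢𝟎 Stab-t independent

    opaque
      isomorphism : ∀ {α β α′ β′} → (α , α′) ~ (β , β′) → Isomorphism α β α′ β′
      isomorphism {α} {β} {α′} {β′} α~β with any? (λ y → rel X α y ≟ rel X α β ×-dec ¬? (y ≟ β))
      ... | yes (y , αy , y≢β) with u , refl ← same-rel⇒translate (sym αy)
        -- The nonzero `u` lies in `Stab α β` and not in `Stab β α`'s role, so `α` and `β` are
        -- exchanged.
        with f , f~f , fβ , fα ← nontrivial⇒isomorphism {t₀ = u} (λ { refl → y≢β (▸-𝟎 β) }) αy (~-sym α~β)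
        = f , f~f , fα , fβ
      ... | no ∄
        -- Here `β` is the only point in its relation to `α`, so `α` determines its image; any `h`
        -- with nontrivial stabiliser at `α` replaces it.
        with h , t , St , t∉ ← X-escapes α 𝟎 𝟎
        with h′ , α~h , _ ← third (~-refl {α , α′}) h
        with f , f~f , refl , _ ← nontrivial⇒isomorphism (Outside.outside-≢𝟎 St t∉) St α~h
        = f , f~f , refl , unique (λ u Su _ → trivial u Su) α~β α~β (f~f α β) (f~f α β)
        where
        trivial : ∀ u → Stab α β u → u ≡ 𝟎
        trivial u Su with (β ▸ u) ≟ β
        ... | yes βu≡β = ▸-injective (trans βu≡β (sym (▸-𝟎 β)))
        ... | no  βu≢β = contradiction (β ▸ u , Su , βu≢β) ∄

    opaque
      isomorphism-bijective : ∀ f → (∀ a b → (a , f a) ~ (b , f b)) → Bijective _≡_ _≡_ f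
      isomorphism-bijective f f~f = injective , λ y → let (x , fx≡y) = surjective y in x , λ { refl → fx≡y }
        where
        injective : ∀ {a b} → f a ≡ f b → a ≡ b
        injective {a} {b} fa≡fb = diag-to X a b (φ-injective (begin
          φ (rel X a b)       ≡⟨ rel-φ (f~f a b) ⟨
          rel Y (f a) (f b)   ≡⟨ cong (rel Y (f a)) fa≡fb ⟨
          rel Y (f a) (f a)   ≡⟨ diag-fro Y (f a) ⟩
          diag Y              ≡⟨ φ-diag ⟨
          φ (diag X)          ∎))
          where open ≡-Reasoning
        surjective : ∀ y → ∃ λ x → f x ≡ y
        surjective y with (α , _) , _ ← nonempty X (diag X)
          -- Some `z` has an image in the same relation to `f α` as `y`; the remaining translation
          -- from `f z` to `y` is applied to `z`.
          with s , φs ← φ-preimage (rel Y (f α) y)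
          with (a , b) , refl ← nonempty X s
          with z , αz , _ ← SX.c-elim {a = α} {b = α} (SX.c-intro {a = a} {b = a} b refl refl (diag-fro X a)) (diag-fro X α)
          with u , refl ← Y.same-rel⇒translate (trans (rel-φ (f~f α z)) (trans (cong φ αz) φs))
          = z ▸ u , Y.▸-unique (trans (rel-φ (f~f z (z ▸ u))) (cong φ (rel-▸ z u)))

-- Schurity and separability.

schurian×separable : ∀ q → Prime (suc q) → (X : Scheme) → Is1pScheme (suc q) X →
  ∀ m → 3 ≤ m → ThinResidueIsE (suc q) m X → Schurian X × Separable X
schurian×separable q p-prime X (valencies , _) m 3≤m (thin , ψ , ψ-injective , ψ∈ , ψ-onto , ψ-⊕) = schurian , separable
  where
  open Translates q m p-prime

  translations : Translations X ψ
  translations = record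
    { ψ-injective = ψ-injective _ _
    ; ψ-thin      = λ u → thin (ψ u) (ψ∈ u)
    ; ψ-⊕         = ψ-⊕
    ; ss*-thin    = λ s t c≢0 → ψ-onto t (gen s t c≢0)
    ; valency≤p   = λ s α → [ (λ ≡1 → ℕ.≤-trans (ℕ.≤-reflexive ≡1) (s≤s z≤n)) , ℕ.≤-reflexive ]′ (valencies s α)
    }

  escape : Action.Escapes translations
  escape = Residue.escapes translations 3≤m ψ∈

  separable : Separable X
  separable Y φ φ-iso =
    let ((α , _) , _) = nonempty X (diag X) ; ((α′ , _) , _) = nonempty Y (diag Y)
        -- The choice of `α` and `α′` is free, as any such pair matches itself.
        (f , f~f , _) = isomorphism (~-refl {α , α′})
    in f , isomorphism-bijective f f~f , λ a b → _~_.rel-φ (f~f a b)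
    where open Extension translations escape {Y} {φ} φ-iso

  schurian : Schurian X
  schurian = Automorphism , (λ _ _ → refl) , (λ g h Kg Kh a b → trans (Kh _ _) (Kg a b)) , flip-closed , transitive ,
    λ α β γ δ → orbital , λ { (g , Kg , refl , refl) → sym (Kg α β) }
    where
    id-iso : AlgIso X X id
    id-iso = (id , λ y → y , id) , λ _ _ _ → refl
    open Extension translations escape {X} {id} id-iso
    -- The group is the full automorphism group of the scheme; isomorphisms for `φ = id` make it
    -- transitive on each basis relation.
    Automorphism : Permutation′ (n X) → Set
    Automorphism g = ∀ a b → rel X (g ⟨$⟩ʳ a) (g ⟨$⟩ʳ b) ≡ rel X a b
    flip-closed : ∀ g → Automorphism g → Automorphism (flip g)
    flip-closed g Kg a b = trans (sym (Kg _ _)) (cong₂ (rel X) (inverseʳ g) (inverseʳ g))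
    orbital : ∀ {α β γ δ} → rel X α β ≡ rel X γ δ → ∃ λ g → Automorphism g × g ⟨$⟩ʳ α ≡ γ × g ⟨$⟩ʳ β ≡ δ
    orbital αβ≡γδ with f , f~f , fα , fβ ← isomorphism (matching (sym αβ≡γδ))
      with injective , surjective ← isomorphism-bijective f f~f
      = permutation f (proj₁ ∘ surjective) (λ y → proj₂ (surjective y) refl)
          (λ x → injective (proj₂ (surjective (f x)) refl)) , (λ a b → _~_.rel-φ (f~f a b)) , fα , fβ
    transitive : ∀ α β → ∃ λ g → Automorphism g × g ⟨$⟩ʳ α ≡ β
    transitive α β with g , Kg , gα , _ ← orbital {α} {α} {β} {β} (trans (diag-fro X α) (sym (diag-fro X β))) = g , Kg , gα

theorem1p4 : ∀ (p : ℕ) → Prime p → (X : Scheme) → Is1pScheme p X →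
    ∀ (m : ℕ) → 3 ≤ m → ThinResidueIsE p m X →
    Schurian X × Separable X
theorem1p4 zero    p-prime = contradiction p-prime ¬prime[0]
theorem1p4 (suc q) p-prime = schurian×separable q p-prime
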